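{- Let $n\ge k>a\ge 0$ be integers. If $n\ge k(k-a+2)-a$ and $k/2>a\ge 1$, then $B(J(n,k,a))=k-a+2$.
   Context: All graphs are finite, undirected, without loops or multiple edges. In a zero forcing process, the vertices of a graph are initially colored black or white; whenever there is a black vertex adjacent to exactly one white vertex, that white vertex is forced to become black, and this is repeated as long as possible. An initial set of black vertices is a zero forcing set if eventually all vertices of the graph become black; otherwise it is a failed zero forcing set, and its complement (the initial set of white vertices) is called a zero blocking set. The zero blocking number $B(G)$ of $G$ is the minimum size of a zero blocking set of $G$. Let $[n]=\{1,2,\ldots,n\}$. For integers $n\ge k>a\ge 0$, the generalized Johnson graph $J(n,k,a)$ is the graph whose vertices are the $k$-subsets of $[n]$, where two vertices $A$ and $B$ are adjacent if and only if $|A\cap B|=a$. -}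

module Defs where

open import Data.Bool.Properties as Bool using ()
open import Data.Fin.Subset using (Subset; inside; outside; ∣_∣; _∩_)
open import Data.Fin.Subset.Properties using (∩-comm; ∩-idem)
open import Data.List.Base using (List; []; _∷_; _++_; length)
import Data.List.Base as List
open import Data.List.Membership.Propositional using (_∈_)
open import Data.List.Membership.Propositional.Properties
  using (∈-map⁺; ∈-++⁺ˡ; ∈-++⁺ʳ)
open import Data.List.Relation.Unary.Any using (here)
open import Data.List.Relation.Unary.Unique.Propositional using (Unique)
open import Data.Nat.Base using (ℕ; zero; suc; _≤_; _<_)
open import Data.Nat.Properties using (_≟_; ≡-irrelevant; <⇒≢)
open import Data.Product.Base using (Σ; ∃-syntax; _×_; _,_)
open import Data.Product.Properties using (≡-dec)
open import Data.Vec.Base using ([]; _∷_)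
import Data.Vec.Properties as Vec
open import Level using (0ℓ)
open import Relation.Binary.Construct.Closure.ReflexiveTransitive using (Star)
open import Relation.Binary.Core using (Rel)
open import Relation.Binary.Definitions
  using (Decidable; DecidableEquality; Symmetric; Irreflexive)
open import Relation.Binary.PropositionalEquality
  using (_≡_; refl; sym; trans; cong)
open import Relation.Nullary.Decidable using (yes; no)
open import Relation.Nullary.Negation using (¬_)
open import Relation.Unary using (Pred; ∁; _∪_; ｛_｝; _≐_; Universal)

record Graph : Set₁ where
  field
    Vertex   : Set
    _≟ᵛ_     : DecidableEquality Vertex
    vertices : List Vertex
    complete : ∀ v → v ∈ vertices
    Adj      : Rel Vertex 0ℓ
    adj?     : Decidable Adj
    symm     : Symmetric Adj
    irrefl   : Irreflexive _≡_ Adj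

module _ (G : Graph) where
  open Graph G

  record VertexSet : Set where
    constructor mkVertexSet
    field
      elements : List Vertex
      distinct : Unique elements

  open VertexSet

  size : VertexSet → ℕ
  size W = length (elements W)

  members : VertexSet → Pred Vertex 0ℓ
  members W v = v ∈ elements W

  -- A colouring is given by its black vertices.
  Colouring : Set₁
  Colouring = Pred Vertex 0ℓ

  -- u can force w: u is black and w is its only white neighbour.
  record CanForce (black : Colouring) (u w : Vertex) : Set where
    field
      u-black  : black u
      adjacent : Adj u w
      w-white  : ¬ black w
      only     : ∀ v → Adj u v → ¬ black v → v ≡ w

  Step : Rel Colouring 0ℓ
  Step black black′ =
    ∃[ u ] ∃[ w ] (CanForce black u w × black′ ≐ (black ∪ ｛ w ｝))

  -- Star allows any number of forces; the order of forces does not affect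
  -- which vertices can eventually become black.
  ZeroForcing : Colouring → Set₁
  ZeroForcing black = ∃[ black′ ] (Star Step black black′ × Universal black′)

  ZeroBlocking : VertexSet → Set₁
  ZeroBlocking W = ¬ ZeroForcing (∁ (members W))

  -- A relation rather than a function, since the graph with no vertices
  -- has no zero blocking set.
  record ZeroBlockingNumber (b : ℕ) : Set₁ where
    field
      attained : ∃[ W ] (ZeroBlocking W × size W ≡ b)
      minimal  : ∀ W → ZeroBlocking W → b ≤ size W

KSubset : ℕ → ℕ → Set
KSubset n k = Σ (Subset n) λ A → ∣ A ∣ ≡ k

_≟ᵏ_ : ∀ {n k} → DecidableEquality (KSubset n k)
_≟ᵏ_ = ≡-dec (Vec.≡-dec Bool._≟_) λ p q → yes (≡-irrelevant p q)

addInside : ∀ {n k} → KSubset n k → KSubset (suc n) (suc k)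
addInside (A , p) = inside ∷ A , cong suc p

addOutside : ∀ {n k} → KSubset n k → KSubset (suc n) k
addOutside (A , p) = outside ∷ A , p

kSubsets : ∀ n k → List (KSubset n k)
kSubsets zero    zero    = ([] , refl) ∷ []
kSubsets zero    (suc k) = []
kSubsets (suc n) zero    = List.map addOutside (kSubsets n zero)
kSubsets (suc n) (suc k) =
  List.map addInside (kSubsets n k) ++ List.map addOutside (kSubsets n (suc k))

∈-kSubsets : ∀ {n k} (A : KSubset n k) → A ∈ kSubsets n k
∈-kSubsets {zero}  {zero}  ([] , refl)          = here refl
∈-kSubsets {suc n} {zero}  (outside ∷ A , p)    =
  ∈-map⁺ addOutside (∈-kSubsets (A , p))
∈-kSubsets {suc n} {suc k} (inside ∷ A , refl)  =
  ∈-++⁺ˡ (∈-map⁺ addInside (∈-kSubsets (A , refl)))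
∈-kSubsets {suc n} {suc k} (outside ∷ A , p)    =
  ∈-++⁺ʳ (List.map addInside (kSubsets n k)) (∈-map⁺ addOutside (∈-kSubsets (A , p)))

-- The hypothesis a < k rules out loops.
J : ∀ n k a → a < k → Graph
J n k a a<k = record
  { Vertex   = KSubset n k
  ; _≟ᵛ_     = _≟ᵏ_
  ; vertices = kSubsets n k
  ; complete = ∈-kSubsets
  ; Adj      = λ (A , _) (B , _) → ∣ A ∩ B ∣ ≡ a
  ; adj?     = λ (A , _) (B , _) → ∣ A ∩ B ∣ ≟ a
  ; symm     = λ { {A , _} {B , _} A∩B → trans (cong ∣_∣ (∩-comm B A)) A∩B }
  ; irrefl   = λ { {A , ∣A∣≡k} refl A∩A →
      <⇒≢ a<k (trans (sym A∩A) (trans (cong ∣_∣ (∩-idem A)) ∣A∣≡k)) }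
  }

{-# OPTIONS --safe #-}

-- Upper bound: take D of size k + 1 and E ⊆ D of size k − a + 2; no vertex has
-- exactly one neighbour among the sets D − e with e ∈ E, so nothing is ever
-- forced.
--
-- Lower bound: among at most k − a + 1 white vertices, some black vertex forces
-- the first one, A. To find it, choose an a-subset S of A such that, for every
-- other white B, S differs from B ∩ A and does not contain A ∖ B. Starting from
-- T = S, as long as some B meets T in exactly a elements, add to T an element of
-- B ∖ (A ∪ T), which exists since S does not contain A ∖ B. Each B needs this at
-- most once, so T ends with at most k elements; pad it to size k outside all
-- white vertices. The result meets A in S, hence is not white.
module Submission where

open import Defs
import Data.Bool.Properties as Bool
open import Data.Empty using (⊥-elim)
open import Data.Fin.Base using (Fin; zero; suc)
import Data.Fin.Properties as Fin
open import Data.Fin.Subset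
  using (Subset; inside; outside; ∣_∣; _∩_; _∪_; _─_; _-_; ∁; ⋃; ⁅_⁆; ⊤; ⊥; _∈_; _∉_; _⊆_; _⊂_)
open import Data.Fin.Subset.Properties
open import Data.List.Base using (List; []; _∷_; length; map; tabulate)
open import Data.List.Membership.Propositional using () renaming (_∈_ to _∈ˡ_)
open import Data.List.Membership.Propositional.Properties using (∈-tabulate⁺; ∈-tabulate⁻)
open import Data.List.Properties using (length-map; length-tabulate; length-removeAt′)
open import Data.List.Relation.Unary.All as All using (All; []; _∷_)
import Data.List.Relation.Unary.All.Properties as All
open import Data.List.Relation.Unary.AllPairs using ([]; _∷_)
open import Data.List.Relation.Unary.Any as Any using (Any; here; there)
open import Data.List.Relation.Unary.Unique.Propositional using (Unique)
open import Data.List.Relation.Unary.Unique.Propositional.Properties using (tabulate⁺)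
open import Data.Nat.Base
  using (ℕ; zero; suc; _+_; _*_; _∸_; _≤_; _<_; _≥_; _>_; z≤n; s≤s; s≤s⁻¹)
open import Data.Nat.Properties
open import Data.Product.Base using (∃-syntax; _×_; _,_; proj₁; proj₂)
open import Data.Sum.Base using (inj₁; inj₂; [_,_]′)
open import Data.Vec.Base using ([]; _∷_; here; there)
import Data.Vec.Properties as Vec
open import Function.Base using (_∘_; id)
open import Relation.Binary.Construct.Closure.ReflexiveTransitive using (ε; _◅_)
open import Relation.Binary.PropositionalEquality
  using (_≡_; _≢_; refl; sym; trans; cong; cong₂; subst)
open import Relation.Nullary.Decidable using (yes; no; _×-dec_)
open import Relation.Nullary.Negation using (¬_; contradiction)
import Relation.Unary as Pred

private
  variable
    n k a : ℕ

-- Cardinalities of unions, intersections and differences of finite sets.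

∣p∪q∣+∣p∩q∣≡∣p∣+∣q∣ : ∀ (p q : Subset n) → ∣ p ∪ q ∣ + ∣ p ∩ q ∣ ≡ ∣ p ∣ + ∣ q ∣
∣p∪q∣+∣p∩q∣≡∣p∣+∣q∣ []            []            = refl
∣p∪q∣+∣p∩q∣≡∣p∣+∣q∣ (outside ∷ p) (outside ∷ q) = ∣p∪q∣+∣p∩q∣≡∣p∣+∣q∣ p q
∣p∪q∣+∣p∩q∣≡∣p∣+∣q∣ (inside ∷ p)  (outside ∷ q) = cong suc (∣p∪q∣+∣p∩q∣≡∣p∣+∣q∣ p q)
∣p∪q∣+∣p∩q∣≡∣p∣+∣q∣ (outside ∷ p) (inside ∷ q)  =
  trans (cong suc (∣p∪q∣+∣p∩q∣≡∣p∣+∣q∣ p q)) (sym (+-suc ∣ p ∣ ∣ q ∣))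
∣p∪q∣+∣p∩q∣≡∣p∣+∣q∣ (inside ∷ p)  (inside ∷ q)  = cong suc
  (trans (+-suc ∣ p ∪ q ∣ ∣ p ∩ q ∣)
    (trans (cong suc (∣p∪q∣+∣p∩q∣≡∣p∣+∣q∣ p q)) (sym (+-suc ∣ p ∣ ∣ q ∣))))

∣p∪q∣≤∣p∣+∣q∣ : ∀ (p q : Subset n) → ∣ p ∪ q ∣ ≤ ∣ p ∣ + ∣ q ∣
∣p∪q∣≤∣p∣+∣q∣ p q =
  ≤-trans (m≤m+n ∣ p ∪ q ∣ ∣ p ∩ q ∣) (≤-reflexive (∣p∪q∣+∣p∩q∣≡∣p∣+∣q∣ p q))

∣p∪⁅x⁆∣≤1+∣p∣ : ∀ (p : Subset n) x → ∣ p ∪ ⁅ x ⁆ ∣ ≤ suc ∣ p ∣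
∣p∪⁅x⁆∣≤1+∣p∣ p x = ≤-trans (∣p∪q∣≤∣p∣+∣q∣ p ⁅ x ⁆)
  (≤-reflexive (trans (cong (∣ p ∣ +_) (∣⁅x⁆∣≡1 x)) (+-comm ∣ p ∣ 1)))

disjoint⇒∣p∪q∣≡∣p∣+∣q∣ : ∀ (p q : Subset n) → (∀ {x} → x ∈ p → x ∉ q) →
                         ∣ p ∪ q ∣ ≡ ∣ p ∣ + ∣ q ∣
disjoint⇒∣p∪q∣≡∣p∣+∣q∣ {n} p q p#q = trans (sym (+-identityʳ _))
  (trans (cong (∣ p ∪ q ∣ +_) (sym ∣p∩q∣≡0)) (∣p∪q∣+∣p∩q∣≡∣p∣+∣q∣ p q))
  where
  ∣p∩q∣≡0 : ∣ p ∩ q ∣ ≡ 0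
  ∣p∩q∣≡0 = trans
    (cong ∣_∣ (Empty-unique λ (_ , x∈p∩q) →
      let x∈p , x∈q = x∈p∩q⁻ p q x∈p∩q in p#q x∈p x∈q))
    (∣⊥∣≡0 n)

∣p∪⁅x⁆∣≡1+∣p∣ : ∀ {p : Subset n} {x} → x ∉ p → ∣ p ∪ ⁅ x ⁆ ∣ ≡ suc ∣ p ∣
∣p∪⁅x⁆∣≡1+∣p∣ {p = p} {x} x∉p = trans
  (disjoint⇒∣p∪q∣≡∣p∣+∣q∣ p ⁅ x ⁆
    (λ {y} y∈p y∈⁅x⁆ → x∉p (subst (_∈ p) (x∈⁅y⁆⇒x≡y x y∈⁅x⁆) y∈p)))
  (trans (cong (∣ p ∣ +_) (∣⁅x⁆∣≡1 x)) (+-comm ∣ p ∣ 1))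

∣p∩q∣+∣p─q∣≡∣p∣ : ∀ (p q : Subset n) → ∣ p ∩ q ∣ + ∣ p ─ q ∣ ≡ ∣ p ∣
∣p∩q∣+∣p─q∣≡∣p∣ []            []            = refl
∣p∩q∣+∣p─q∣≡∣p∣ (outside ∷ p) (outside ∷ q) = ∣p∩q∣+∣p─q∣≡∣p∣ p q
∣p∩q∣+∣p─q∣≡∣p∣ (outside ∷ p) (inside ∷ q)  = ∣p∩q∣+∣p─q∣≡∣p∣ p q
∣p∩q∣+∣p─q∣≡∣p∣ (inside ∷ p)  (inside ∷ q)  = cong suc (∣p∩q∣+∣p─q∣≡∣p∣ p q)
∣p∩q∣+∣p─q∣≡∣p∣ (inside ∷ p)  (outside ∷ q) =
  trans (+-suc ∣ p ∩ q ∣ ∣ p ─ q ∣) (cong suc (∣p∩q∣+∣p─q∣≡∣p∣ p q))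

q⊆p⇒p∩q≡q : ∀ {p q : Subset n} → q ⊆ p → p ∩ q ≡ q
q⊆p⇒p∩q≡q {p = p} {q} q⊆p = ⊆-antisym (p∩q⊆q p q) λ x∈q → x∈p∩q⁺ (q⊆p x∈q , x∈q)

q⊆p⇒∣q∣+∣p─q∣≡∣p∣ : ∀ {p q : Subset n} → q ⊆ p → ∣ q ∣ + ∣ p ─ q ∣ ≡ ∣ p ∣
q⊆p⇒∣q∣+∣p─q∣≡∣p∣ {p = p} {q} q⊆p =
  trans (cong (λ r → ∣ r ∣ + ∣ p ─ q ∣) (sym (q⊆p⇒p∩q≡q q⊆p))) (∣p∩q∣+∣p─q∣≡∣p∣ p q)

x∈p⇒1+∣p-x∣≡∣p∣ : ∀ {p : Subset n} {x} → x ∈ p → suc ∣ p - x ∣ ≡ ∣ p ∣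
x∈p⇒1+∣p-x∣≡∣p∣ {p = p} {x} x∈p = trans
  (cong (_+ ∣ p - x ∣) (sym (∣⁅x⁆∣≡1 x)))
  (q⊆p⇒∣q∣+∣p─q∣≡∣p∣ λ y∈⁅x⁆ → subst (_∈ p) (sym (x∈⁅y⁆⇒x≡y x y∈⁅x⁆)) x∈p)

x∈p─q⇒x∉q : ∀ (p q : Subset n) {x} → x ∈ p ─ q → x ∉ q
x∈p─q⇒x∉q (_ ∷ p) (inside  ∷ q) (there x∈) (there x∈q) = x∈p─q⇒x∉q p q x∈ x∈q
x∈p─q⇒x∉q (_ ∷ p) (outside ∷ q) (there x∈) (there x∈q) = x∈p─q⇒x∉q p q x∈ x∈q

x∉p-x : ∀ (p : Subset n) x → x ∉ p - x
x∉p-x p x x∈p-x = x∈p─q⇒x∉q p ⁅ x ⁆ x∈p-x (x∈⁅x⁆ x)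

x∉p⇒p-x≡p : ∀ {p : Subset n} {x} → x ∉ p → p - x ≡ p
x∉p⇒p-x≡p {p = p} {x} x∉p = ⊆-antisym (p─q⊆p p ⁅ x ⁆)
  λ {y} y∈p → x∈p∧x≢y⇒x∈p-y y∈p λ { refl → x∉p y∈p }

p∩[q─r]≡p∩q─r : ∀ (p q r : Subset n) → p ∩ (q ─ r) ≡ p ∩ q ─ r
p∩[q─r]≡p∩q─r []      []      []            = refl
p∩[q─r]≡p∩q─r (s ∷ p) (t ∷ q) (inside  ∷ r) = cong₂ _∷_ (Bool.∧-zeroʳ s) (p∩[q─r]≡p∩q─r p q r)
p∩[q─r]≡p∩q─r (s ∷ p) (t ∷ q) (outside ∷ r) = cong (_ ∷_) (p∩[q─r]≡p∩q─r p q r)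

p-x≡p-y⇒x≡y : ∀ {p : Subset n} {x y} → x ∈ p → p - x ≡ p - y → x ≡ y
p-x≡p-y⇒x≡y {p = p} {x} {y} x∈p eq with x Fin.≟ y
... | yes x≡y = x≡y
... | no  x≢y =
  contradiction (subst (x ∈_) (sym eq) (x∈p∧x≢y⇒x∈p-y x∈p x≢y)) (x∉p-x p x)

-- Unions of families of `k`-sets, and subsets of prescribed size.

∣⋃∣≤ : ∀ {k} (ps : List (Subset n)) → All (λ p → ∣ p ∣ ≡ k) ps → ∣ ⋃ ps ∣ ≤ length ps * k
∣⋃∣≤ {n} []       []            = ≤-reflexive (∣⊥∣≡0 n)
∣⋃∣≤     (p ∷ ps) (refl ∷ ∣ps∣) =
  ≤-trans (∣p∪q∣≤∣p∣+∣q∣ p (⋃ ps)) (+-monoʳ-≤ ∣ p ∣ (∣⋃∣≤ ps ∣ps∣))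

-- Supplies the points outside every white vertex that later pad a forcing vertex to size `k`.
m≤∣∁⋃∣ : ∀ {k m} (ps : List (Subset n)) → All (λ p → ∣ p ∣ ≡ k) ps →
         length ps * k + m ≤ n → m ≤ ∣ ∁ (⋃ ps) ∣
m≤∣∁⋃∣ {n} {k} {m} ps ∣ps∣ large = begin
  m                                 ≡⟨ sym (m+n∸m≡n (length ps * k) m) ⟩
  length ps * k + m ∸ length ps * k ≤⟨ ∸-mono large (∣⋃∣≤ ps ∣ps∣) ⟩
  n ∸ ∣ ⋃ ps ∣                      ≡⟨ sym (∣∁p∣≡n∸∣p∣ (⋃ ps)) ⟩
  ∣ ∁ (⋃ ps) ∣                      ∎
  where open ≤-Reasoning

All-⊆⋃ : ∀ (ps : List (Subset n)) → All (_⊆ ⋃ ps) ps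
All-⊆⋃ []       = []
All-⊆⋃ (p ∷ ps) =
  p⊆p∪q (⋃ ps) ∷ All.map (λ q⊆ {x} x∈q → q⊆p∪q p (⋃ ps) (q⊆ x∈q)) (All-⊆⋃ ps)

subsetOfSize : ∀ (p : Subset n) m → m ≤ ∣ p ∣ → ∃[ q ] (q ⊆ p × ∣ q ∣ ≡ m)
subsetOfSize []            zero    _   = [] , id , refl
subsetOfSize (outside ∷ p) m       m≤ =
  let q , q⊆p , ∣q∣ = subsetOfSize p m m≤ in outside ∷ q , s⊆s q⊆p , ∣q∣
subsetOfSize (inside ∷ p)  zero    _   =
  let q , q⊆p , ∣q∣ = subsetOfSize p zero z≤n in outside ∷ q , out⊆ q⊆p , ∣q∣
subsetOfSize (inside ∷ p)  (suc m) m≤ =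
  let q , q⊆p , ∣q∣ = subsetOfSize p m (s≤s⁻¹ m≤) in inside ∷ q , s⊆s q⊆p , cong suc ∣q∣

0<∣p∣⇒Nonempty : ∀ (p : Subset n) → 0 < ∣ p ∣ → ∃[ x ] x ∈ p
0<∣p∣⇒Nonempty {n} p 0<∣p∣ with nonempty? p
... | yes p≠∅ = p≠∅
... | no  p=∅ = contradiction
  (subst (0 <_) (trans (cong ∣_∣ (Empty-unique p=∅)) (∣⊥∣≡0 n)) 0<∣p∣) (<-irrefl refl)

p⊈q⇒∃x∈p∖q : ∀ {p q : Subset n} → ¬ (p ⊆ q) → ∃[ x ] (x ∈ p × x ∉ q)
p⊈q⇒∃x∈p∖q {p = p} {q} p⊈q with nonempty? (p ─ q)
... | yes (x , x∈p─q) = x , p─q⊆p p q x∈p─q , x∈p─q⇒x∉q p q x∈p─q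
... | no  empty       = ⊥-elim (p⊈q p⊆q)
  where
  p⊆q : p ⊆ q
  p⊆q {x} x∈p with x ∈? q
  ... | yes x∈q = x∈q
  ... | no  x∉q = ⊥-elim (empty (x , x∈p∧x∉q⇒x∈p─q x∈p x∉q))

∣q∣<∣p∣⇒∃x∈p∖q : ∀ {p q : Subset n} → ∣ q ∣ < ∣ p ∣ → ∃[ x ] (x ∈ p × x ∉ q)
∣q∣<∣p∣⇒∃x∈p∖q ∣q∣<∣p∣ = p⊈q⇒∃x∈p∖q (λ p⊆q → <⇒≱ ∣q∣<∣p∣ (p⊆q⇒∣p∣≤∣q∣ p⊆q))

p⊆q∧∣q∣≤∣p∣⇒p≡q : ∀ {p q : Subset n} → p ⊆ q → ∣ q ∣ ≤ ∣ p ∣ → p ≡ q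
p⊆q∧∣q∣≤∣p∣⇒p≡q {p = p} {q} p⊆q ∣q∣≤∣p∣ with q ⊆? p
... | yes q⊆p = ⊆-antisym p⊆q q⊆p
... | no  q⊈p =
  contradiction (p⊂q⇒∣p∣<∣q∣ (p⊆q , p⊈q⇒∃x∈p∖q q⊈p)) (≤⇒≯ ∣q∣≤∣p∣)

disjoint⇒[p∪q]∩r≡p∩r : ∀ (p q r : Subset n) → (∀ {x} → x ∈ q → x ∉ r) →
                       (p ∪ q) ∩ r ≡ p ∩ r
disjoint⇒[p∪q]∩r≡p∩r p q r q#r = ⊆-antisym to from
  where
  to : (p ∪ q) ∩ r ⊆ p ∩ r
  to x∈ with x∈p∪q , x∈r ← x∈p∩q⁻ (p ∪ q) r x∈ =
    x∈p∩q⁺ ([ id , (λ x∈q → contradiction x∈r (q#r x∈q)) ]′ (x∈p∪q⁻ p q x∈p∪q) , x∈r)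
  from : p ∩ r ⊆ (p ∪ q) ∩ r
  from x∈ with x∈p , x∈r ← x∈p∩q⁻ p r x∈ = x∈p∩q⁺ (p⊆p∪q q x∈p , x∈r)

-- The increasing enumeration of `p`. It turns `E` into an index type, so that the blocking set is a
-- `tabulate` and its distinctness is injectivity.
enum : ∀ (p : Subset n) → Fin ∣ p ∣ → Fin n
enum (outside ∷ p) i       = suc (enum p i)
enum (inside  ∷ p) zero    = zero
enum (inside  ∷ p) (suc i) = suc (enum p i)

enum-∈ : ∀ (p : Subset n) i → enum p i ∈ p
enum-∈ (outside ∷ p) i       = there (enum-∈ p i)
enum-∈ (inside  ∷ p) zero    = here
enum-∈ (inside  ∷ p) (suc i) = there (enum-∈ p i)

enum-injective : ∀ (p : Subset n) {i j} → enum p i ≡ enum p j → i ≡ j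
enum-injective (outside ∷ p)                 eq = enum-injective p (Fin.suc-injective eq)
enum-injective (inside  ∷ p) {zero}  {zero}  eq = refl
enum-injective (inside  ∷ p) {suc i} {suc j} eq =
  cong suc (enum-injective p (Fin.suc-injective eq))

enum-surjective : ∀ (p : Subset n) {x} → x ∈ p → ∃[ i ] enum p i ≡ x
enum-surjective (inside  ∷ p) here        = zero , refl
enum-surjective (inside  ∷ p) (there x∈p) =
  let i , eq = enum-surjective p x∈p in suc i , cong suc eq
enum-surjective (outside ∷ p) (there x∈p) =
  let i , eq = enum-surjective p x∈p in i , cong suc eq

KSubset-≡ : ∀ {A B : KSubset n k} → proj₁ A ≡ proj₁ B → A ≡ B
KSubset-≡ {A = A , p} {B = .A , q} refl = cong (A ,_) (≡-irrelevant p q)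

-- The upper bound

-- For fixed `u`, the size of `u ∩ (D - x)` with `x ∈ E` depends only on whether `x ∈ u`, so all `x`
-- on the same side as `e` give neighbours too. If `e ∈ u`, uniqueness leaves `e` as the only point
-- of `E` in `u`, and `u ∩ D`, of size `a + 1`, has at most `∣ D ─ E ∣ + 1 ≤ a` points. If `e ∉ u`,
-- all of `E` except `e` lies in `u ∩ D`, of size `a`, and `E` is too small.
noUniqueNeighbour : ∀ {D E : Subset n} → E ⊆ D → ∣ D ─ E ∣ < a → suc a < ∣ E ∣ →
  ∀ u e → e ∈ E → ∣ u ∩ (D - e) ∣ ≡ a →
  ¬ (∀ {x} → x ∈ E → ∣ u ∩ (D - x) ∣ ≡ a → x ≡ e)
noUniqueNeighbour {a = a} {D} {E} E⊆D ∣D─E∣<a a+1<∣E∣ u e e∈E adj unique with e ∈? u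
... | yes e∈u = contradiction a+1≤a (<⇒≱ ≤-refl)
  where
  ∣u∩[D-x]∣ : ∀ {x} → x ∈ u → x ∈ E → suc ∣ u ∩ (D - x) ∣ ≡ ∣ u ∩ D ∣
  ∣u∩[D-x]∣ {x} x∈u x∈E = trans (cong (suc ∘ ∣_∣) (p∩[q─r]≡p∩q─r u D ⁅ x ⁆))
    (x∈p⇒1+∣p-x∣≡∣p∣ (x∈p∩q⁺ (x∈u , E⊆D x∈E)))
  ∣u∩D∣≡1+a : ∣ u ∩ D ∣ ≡ suc a
  ∣u∩D∣≡1+a = trans (sym (∣u∩[D-x]∣ e∈u e∈E)) (cong suc adj)
  u∩D⊆ : u ∩ D ⊆ (D ─ E) ∪ ⁅ e ⁆
  u∩D⊆ {x} x∈u∩D with x∈p∩q⁻ u D x∈u∩D | x ∈? E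
  ... | x∈u , x∈D | no x∉E  = x∈p∪q⁺ (inj₁ (x∈p∧x∉q⇒x∈p─q x∈D x∉E))
  ... | x∈u , x∈D | yes x∈E = x∈p∪q⁺ {q = ⁅ e ⁆} (inj₂
    (subst (_∈ ⁅ e ⁆)
      (sym (unique x∈E (suc-injective (trans (∣u∩[D-x]∣ x∈u x∈E) ∣u∩D∣≡1+a))))
      (x∈⁅x⁆ e)))
  a+1≤a : suc a ≤ a
  a+1≤a = ≤-trans (≤-reflexive (sym ∣u∩D∣≡1+a))
    (≤-trans (p⊆q⇒∣p∣≤∣q∣ u∩D⊆) (≤-trans (∣p∪⁅x⁆∣≤1+∣p∣ (D ─ E) e) ∣D─E∣<a))
... | no e∉u = contradiction ∣E∣≤1+a (<⇒≱ a+1<∣E∣)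
  where
  ∣u∩[D-x]∣ : ∀ {x} → x ∉ u → ∣ u ∩ (D - x) ∣ ≡ ∣ u ∩ D ∣
  ∣u∩[D-x]∣ {x} x∉u = cong ∣_∣ (trans (p∩[q─r]≡p∩q─r u D ⁅ x ⁆)
    (x∉p⇒p-x≡p (x∉u ∘ p∩q⊆p u D)))
  ∣u∩D∣≡a : ∣ u ∩ D ∣ ≡ a
  ∣u∩D∣≡a = trans (sym (∣u∩[D-x]∣ e∉u)) adj
  E⊆ : E ⊆ (u ∩ D) ∪ ⁅ e ⁆
  E⊆ {x} x∈E with x ∈? u
  ... | yes x∈u = x∈p∪q⁺ (inj₁ (x∈p∩q⁺ (x∈u , E⊆D x∈E)))
  ... | no  x∉u = x∈p∪q⁺ {q = ⁅ e ⁆} (inj₂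
    (subst (_∈ ⁅ e ⁆) (sym (unique x∈E (trans (∣u∩[D-x]∣ x∉u) ∣u∩D∣≡a))) (x∈⁅x⁆ e)))
  ∣E∣≤1+a : ∣ E ∣ ≤ suc a
  ∣E∣≤1+a = ≤-trans (p⊆q⇒∣p∣≤∣q∣ E⊆)
    (≤-trans (∣p∪⁅x⁆∣≤1+∣p∣ (u ∩ D) e) (≤-reflexive (cong suc ∣u∩D∣≡a)))

module _ (a<k : a < k) {D E : Subset n} (∣D∣≡1+k : ∣ D ∣ ≡ suc k) (E⊆D : E ⊆ D) where

  private
    G = J n k a a<k

  removal : Fin ∣ E ∣ → KSubset n k
  removal i = D - enum E i ,
    suc-injective (trans (x∈p⇒1+∣p-x∣≡∣p∣ (E⊆D (enum-∈ E i))) ∣D∣≡1+k)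

  removal-injective : ∀ {i j} → removal i ≡ removal j → i ≡ j
  removal-injective {i} eq =
    enum-injective E (p-x≡p-y⇒x≡y (E⊆D (enum-∈ E i)) (cong proj₁ eq))

  removals : VertexSet G
  removals = mkVertexSet (tabulate removal) (tabulate⁺ removal-injective)

  -- Only the start of the process matters: with no force at all some vertex is white because `E` is
  -- nonempty, and a first force would need a unique white neighbour.
  removals-blocking : ∣ D ─ E ∣ < a → suc a < ∣ E ∣ → ZeroBlocking G removals
  removals-blocking ∣D─E∣<a a+1<∣E∣ (_ , ε , all-black) =
    let x , x∈E = 0<∣p∣⇒Nonempty E (≤-trans (s≤s z≤n) a+1<∣E∣)
        i , _   = enum-surjective E x∈E
    in all-black (removal i) (∈-tabulate⁺ i)
  removals-blocking ∣D─E∣<a a+1<∣E∣ (_ , (u , w , force , _) ◅ _ , _) =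
    -- A white vertex is a removal only up to double negation, which suffices because the goal is
    -- `⊥`.
    w-white λ w∈ → case-w (∈-tabulate⁻ w∈)
    where
    open CanForce force
    case-w : ¬ (∃[ i ] w ≡ removal i)
    case-w (i , refl) =
      noUniqueNeighbour E⊆D ∣D─E∣<a a+1<∣E∣ (proj₁ u) (enum E i) (enum-∈ E i) adjacent unique
      where
      unique : ∀ {x} → x ∈ E → ∣ proj₁ u ∩ (D - x) ∣ ≡ a → x ≡ enum E i
      unique x∈E adj with enum-surjective E x∈E
      ... | j , refl = cong (enum E) (removal-injective
        (only (removal j) adj λ black → black (∈-tabulate⁺ j)))

-- The lower bound

-- Pigeonhole: since `X` is disjoint from `R`, each `C` equals `R ∪ ⁅ x ⁆` for at most one `x ∈ X`,
-- so fewer sets than points cannot exclude every `x`.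
≢-candidate : ∀ {R : Subset n} (Cs : List (Subset n)) (X : Subset n) →
  (∀ {x} → x ∈ X → x ∉ R) → length Cs < ∣ X ∣ →
  ∃[ x ] (x ∈ X × All (_≢ R ∪ ⁅ x ⁆) Cs)
≢-candidate []       X X#R <∣X∣ = let x , x∈X = 0<∣p∣⇒Nonempty X <∣X∣ in x , x∈X , []
≢-candidate {R = R} (C ∷ Cs) X X#R <∣X∣
  with Fin.any? (λ x → x ∈? X ×-dec Vec.≡-dec Bool._≟_ C (R ∪ ⁅ x ⁆))
... | no ¬hit =
  let x , x∈X , Cs≢ = ≢-candidate Cs X X#R (<-trans ≤-refl <∣X∣)
  in x , x∈X , (λ C≡ → ¬hit (x , x∈X , C≡)) ∷ Cs≢
-- `C` excludes exactly `y`; discarding both lowers each side of the bound by one.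
... | yes (y , y∈X , refl) =
  let X-y⊆X = p─q⊆p X ⁅ y ⁆
      x , x∈X-y , Cs≢ = ≢-candidate Cs (X - y) (X#R ∘ X-y⊆X)
        (s≤s⁻¹ (≤-trans <∣X∣ (≤-reflexive (sym (x∈p⇒1+∣p-x∣≡∣p∣ y∈X)))))
  in x , X-y⊆X x∈X-y , R∪⁅y⁆≢ x∈X-y ∷ Cs≢
  where
  R∪⁅y⁆≢ : ∀ {x} → x ∈ X - y → R ∪ ⁅ y ⁆ ≢ R ∪ ⁅ x ⁆
  R∪⁅y⁆≢ {x} x∈X-y eq
    with x∈p∪q⁻ R ⁅ x ⁆ (subst (y ∈_) eq (q⊆p∪q R ⁅ y ⁆ (x∈⁅x⁆ y)))
  ... | inj₁ y∈R   = X#R y∈X y∈R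
  ... | inj₂ y∈⁅x⁆ = x∉p-x X y (subst (_∈ X - y) (sym (x∈⁅y⁆⇒x≡y x y∈⁅x⁆)) x∈X-y)

-- For 0 < a the number of a-subsets of a set with k elements exceeds k − a: fix
-- a − 1 elements and vary the last one.
subset-avoiding : ∀ (A : Subset n) (Cs : List (Subset n)) → 0 < a → length Cs + a ≤ ∣ A ∣ →
  ∃[ S ] (S ⊆ A × ∣ S ∣ ≡ a × All (_≢ S) Cs)
subset-avoiding {a = suc r} A Cs _ len
  with R , R⊆A , refl ← subsetOfSize A r
         (≤-trans (n≤1+n r) (≤-trans (m≤n+m (suc r) (length Cs)) len))
  =
  let x , x∈A─R , Cs≢ = ≢-candidate Cs (A ─ R) (x∈p─q⇒x∉q A R) len<∣A─R∣
  in R ∪ ⁅ x ⁆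
   , (λ y∈ → [ R⊆A , (λ y∈⁅x⁆ → subst (_∈ A) (sym (x∈⁅y⁆⇒x≡y x y∈⁅x⁆)) (p─q⊆p A R x∈A─R)) ]′
       (x∈p∪q⁻ R ⁅ x ⁆ y∈))
   , ∣p∪⁅x⁆∣≡1+∣p∣ (x∈p─q⇒x∉q A R x∈A─R)
   , Cs≢
  where
  len<∣A─R∣ : length Cs < ∣ A ─ R ∣
  len<∣A─R∣ = +-cancelˡ-≤ ∣ R ∣ _ _ (begin
    ∣ R ∣ + suc (length Cs) ≡⟨ +-comm ∣ R ∣ (suc (length Cs)) ⟩
    suc (length Cs) + ∣ R ∣ ≡⟨ sym (+-suc (length Cs) ∣ R ∣) ⟩
    length Cs + suc ∣ R ∣   ≤⟨ len ⟩
    ∣ A ∣                   ≡⟨ sym (q⊆p⇒∣q∣+∣p─q∣≡∣p∣ R⊆A) ⟩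
    ∣ R ∣ + ∣ A ─ R ∣       ∎)
    where open ≤-Reasoning

-- The inequality keeps the eventual forcing vertex `u`, for which `u ∩ A ≡ S`, from being `B`. The
-- point `h` makes `S ─ B` smaller than `A ─ B`, which leaves room in `B ─ A` for a new element.
record Separates (A S B : Subset n) : Set where
  constructor separates
  field
    B∩A≢S  : B ∩ A ≢ S
    {h}    : Fin n
    h∈A    : h ∈ A
    h∉B    : h ∉ B
    h∉S    : h ∉ S

-- If ∣B ∩ A∣ = a, then A ∖ B is too large to lie in S and only S ≢ B ∩ A has to
-- be arranged; otherwise S ≢ B ∩ A is automatic and S has to miss a point of
-- A ∖ B.
separation-constraints : ∀ {A : Subset n} → ∣ A ∣ ≡ k → 2 * a < k →
  ∀ Bs → All (λ B → ∣ B ∣ ≡ k × B ≢ A) Bs →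
  ∃[ H ] ∃[ Cs ] (∣ H ∣ + length Cs ≤ length Bs ×
    (∀ S → S ⊆ A ─ H → ∣ S ∣ ≡ a → All (_≢ S) Cs → All (Separates A S) Bs))
separation-constraints {n} ∣A∣ 2a<k [] [] =
  ⊥ , [] , ≤-reflexive (trans (+-identityʳ _) (∣⊥∣≡0 n)) , λ _ _ _ _ → []
separation-constraints {n} {k} {a} {A} ∣A∣ 2a<k (B ∷ Bs) ((∣B∣ , B≢A) ∷ Bs≢A)
  -- `H` collects points that `S` must miss, `Cs` sets that it must differ from. Each `B` adds at
  -- most one entry to just one of them, which gives the bound on the total.
  with H , Cs , len , good ← separation-constraints ∣A∣ 2a<k Bs Bs≢A
  with ∣ B ∩ A ∣ ≟ a
... | yes ∣B∩A∣≡a = H , (B ∩ A) ∷ Cs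
    , ≤-trans (≤-reflexive (+-suc ∣ H ∣ (length Cs))) (s≤s len)
    , good′
  where
  a<∣A─B∣ : a < ∣ A ─ B ∣
  a<∣A─B∣ = +-cancelˡ-< a a ∣ A ─ B ∣ (begin-strict
    a + a                 ≡⟨ cong (a +_) (sym (+-identityʳ a)) ⟩
    2 * a                 <⟨ 2a<k ⟩
    k                     ≡⟨ sym ∣A∣ ⟩
    ∣ A ∣                 ≡⟨ sym (∣p∩q∣+∣p─q∣≡∣p∣ A B) ⟩
    ∣ A ∩ B ∣ + ∣ A ─ B ∣ ≡⟨ cong (λ p → ∣ p ∣ + ∣ A ─ B ∣) (∩-comm A B) ⟩
    ∣ B ∩ A ∣ + ∣ A ─ B ∣ ≡⟨ cong (_+ ∣ A ─ B ∣) ∣B∩A∣≡a ⟩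
    a + ∣ A ─ B ∣         ∎)
    where open ≤-Reasoning
  good′ : ∀ S → S ⊆ A ─ H → ∣ S ∣ ≡ a → All (_≢ S) (B ∩ A ∷ Cs) → All (Separates A S) (B ∷ Bs)
  good′ S S⊆ ∣S∣ (B∩A≢S ∷ Cs≢S) =
    let x , x∈A─B , x∉S = ∣q∣<∣p∣⇒∃x∈p∖q (subst (_< ∣ A ─ B ∣) (sym ∣S∣) a<∣A─B∣)
    in separates B∩A≢S (p─q⊆p A B x∈A─B) (x∈p─q⇒x∉q A B x∈A─B) x∉S ∷ good S S⊆ ∣S∣ Cs≢S
... | no ∣B∩A∣≢a = H ∪ ⁅ h ⁆ , Cs
    , ≤-trans (+-monoˡ-≤ (length Cs) (∣p∪⁅x⁆∣≤1+∣p∣ H h)) (s≤s len)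
    , good′
  where
  outside-B : ∃[ h ] (h ∈ A × h ∉ B)
  outside-B = p⊈q⇒∃x∈p∖q λ A⊆B →
    B≢A (sym (p⊆q∧∣q∣≤∣p∣⇒p≡q A⊆B (≤-reflexive (trans ∣B∣ (sym ∣A∣)))))
  h = proj₁ outside-B
  good′ : ∀ S → S ⊆ A ─ (H ∪ ⁅ h ⁆) → ∣ S ∣ ≡ a → All (_≢ S) Cs → All (Separates A S) (B ∷ Bs)
  good′ S S⊆ ∣S∣ Cs≢S =
    separates (λ B∩A≡S → ∣B∩A∣≢a (trans (cong ∣_∣ B∩A≡S) ∣S∣))
              (proj₁ (proj₂ outside-B)) (proj₂ (proj₂ outside-B))
              (λ h∈S → x∈p─q⇒x∉q A (H ∪ ⁅ h ⁆) (S⊆ h∈S) (q⊆p∪q H ⁅ h ⁆ (x∈⁅x⁆ h)))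
    ∷ good S (λ x∈S → x∈p∧x∉q⇒x∈p─q (p─q⊆p A (H ∪ ⁅ h ⁆) (S⊆ x∈S))
                (λ x∈H → x∈p─q⇒x∉q A (H ∪ ⁅ h ⁆) (S⊆ x∈S) (p⊆p∪q ⁅ h ⁆ x∈H)))
           ∣S∣ Cs≢S

-- One budget `k ∸ a` pays for both kinds of constraint: the forbidden points are removed from `A`,
-- and what remains is still large enough to avoid the forbidden sets.
separating-subset : ∀ {A : Subset n} → ∣ A ∣ ≡ k → 0 < a → 2 * a < k →
  ∀ Bs → All (λ B → ∣ B ∣ ≡ k × B ≢ A) Bs → length Bs + a ≤ k →
  ∃[ S ] (S ⊆ A × ∣ S ∣ ≡ a × All (Separates A S) Bs)
separating-subset {k = k} {a} {A} ∣A∣ 0<a 2a<k Bs Bs≢A len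
  with H , Cs , ∣H∣+∣Cs∣≤ , good ← separation-constraints ∣A∣ 2a<k Bs Bs≢A
  =
  let S , S⊆A─H , ∣S∣ , Cs≢S = subset-avoiding (A ─ H) Cs 0<a enough
  in S , p─q⊆p A H ∘ S⊆A─H , ∣S∣ , good S S⊆A─H ∣S∣ Cs≢S
  where
  enough : length Cs + a ≤ ∣ A ─ H ∣
  enough = +-cancelˡ-≤ ∣ H ∣ _ _ (begin
    ∣ H ∣ + (length Cs + a) ≡⟨ sym (+-assoc ∣ H ∣ (length Cs) a) ⟩
    ∣ H ∣ + length Cs + a   ≤⟨ +-monoˡ-≤ a ∣H∣+∣Cs∣≤ ⟩
    length Bs + a           ≤⟨ len ⟩
    k                       ≡⟨ sym ∣A∣ ⟩
    ∣ A ∣                   ≡⟨ sym (∣p∩q∣+∣p─q∣≡∣p∣ A H) ⟩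
    ∣ A ∩ H ∣ + ∣ A ─ H ∣   ≤⟨ +-monoˡ-≤ ∣ A ─ H ∣ (∣p∩q∣≤∣q∣ A H) ⟩
    ∣ H ∣ + ∣ A ─ H ∣       ∎)
    where open ≤-Reasoning

-- ∣(T ∩ B) ∖ A∣ = ∣S ∖ B∣ < ∣A ∖ B∣ = ∣B ∖ A∣.
fresh-element : ∀ {A B S T : Subset n} → ∣ A ∣ ≡ ∣ B ∣ → S ⊆ A → T ∩ A ≡ S →
  Separates A S B → ∣ T ∩ B ∣ ≡ ∣ S ∣ → ∃[ y ] (y ∈ B × y ∉ A × y ∉ T)
fresh-element {A = A} {B} {S} {T} ∣A∣≡∣B∣ S⊆A T∩A≡S (separates _ h∈A h∉B h∉S) ∣T∩B∣≡∣S∣ =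
  let y , y∈B─A , y∉ = ∣q∣<∣p∣⇒∃x∈p∖q {q = T ∩ B ─ A} room
      y∈B = p─q⊆p B A y∈B─A
      y∉A = x∈p─q⇒x∉q B A y∈B─A
  in y , y∈B , y∉A , λ y∈T → y∉ (x∈p∧x∉q⇒x∈p─q (x∈p∩q⁺ (y∈T , y∈B)) y∉A)
  where
  open ≤-Reasoning
  S∩B≡ : S ∩ B ≡ (T ∩ B) ∩ A
  S∩B≡ = trans (cong (_∩ B) (sym T∩A≡S))
    (trans (∩-assoc T A B) (trans (cong (T ∩_) (∩-comm A B)) (sym (∩-assoc T B A))))
  ∣T∩B─A∣≡∣S─B∣ : ∣ T ∩ B ─ A ∣ ≡ ∣ S ─ B ∣
  ∣T∩B─A∣≡∣S─B∣ = +-cancelˡ-≡ ∣ S ∩ B ∣ _ _ (begin-equality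
    ∣ S ∩ B ∣ + ∣ T ∩ B ─ A ∣       ≡⟨ cong (λ p → ∣ p ∣ + ∣ T ∩ B ─ A ∣) S∩B≡ ⟩
    ∣ (T ∩ B) ∩ A ∣ + ∣ T ∩ B ─ A ∣ ≡⟨ ∣p∩q∣+∣p─q∣≡∣p∣ (T ∩ B) A ⟩
    ∣ T ∩ B ∣                       ≡⟨ ∣T∩B∣≡∣S∣ ⟩
    ∣ S ∣                           ≡⟨ sym (∣p∩q∣+∣p─q∣≡∣p∣ S B) ⟩
    ∣ S ∩ B ∣ + ∣ S ─ B ∣           ∎)
  ∣A─B∣≡∣B─A∣ : ∣ A ─ B ∣ ≡ ∣ B ─ A ∣
  ∣A─B∣≡∣B─A∣ = +-cancelˡ-≡ ∣ A ∩ B ∣ _ _ (begin-equality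
    ∣ A ∩ B ∣ + ∣ A ─ B ∣ ≡⟨ ∣p∩q∣+∣p─q∣≡∣p∣ A B ⟩
    ∣ A ∣                 ≡⟨ ∣A∣≡∣B∣ ⟩
    ∣ B ∣                 ≡⟨ sym (∣p∩q∣+∣p─q∣≡∣p∣ B A) ⟩
    ∣ B ∩ A ∣ + ∣ B ─ A ∣ ≡⟨ cong (λ p → ∣ p ∣ + ∣ B ─ A ∣) (∩-comm B A) ⟩
    ∣ A ∩ B ∣ + ∣ B ─ A ∣ ∎)
  S─B⊂A─B : S ─ B ⊂ A ─ B
  S─B⊂A─B = (λ x∈ → x∈p∧x∉q⇒x∈p─q (S⊆A (p─q⊆p S B x∈)) (x∈p─q⇒x∉q S B x∈))
    , _ , x∈p∧x∉q⇒x∈p─q h∈A h∉B , h∉S ∘ p─q⊆p S B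
  room : ∣ T ∩ B ─ A ∣ < ∣ B ─ A ∣
  room = begin-strict
    ∣ T ∩ B ─ A ∣ ≡⟨ ∣T∩B─A∣≡∣S─B∣ ⟩
    ∣ S ─ B ∣     <⟨ p⊂q⇒∣p∣<∣q∣ S─B⊂A─B ⟩
    ∣ A ─ B ∣     ≡⟨ ∣A─B∣≡∣B─A∣ ⟩
    ∣ B ─ A ∣     ∎

module _ {A S U : Subset n} (S⊆A : S ⊆ A) where

  -- Once an element of B has been added, B meets T in more than ∣S∣ elements and
  -- stays so; hence B can be dropped from the list.
  extend-avoiding : ∀ m Bs → length Bs ≤ m →
    All (λ B → ∣ A ∣ ≡ ∣ B ∣ × B ⊆ U × Separates A S B) Bs →
    ∀ T → T ⊆ U → T ∩ A ≡ S →
    ∃[ T′ ] (T ⊆ T′ × T′ ⊆ U × T′ ∩ A ≡ S × ∣ T′ ∣ ≤ ∣ T ∣ + m ×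
             All (λ B → ∣ T′ ∩ B ∣ ≢ ∣ S ∣) Bs)
  extend-avoiding m Bs len sep T T⊆U T∩A with Any.any? (λ B → ∣ T ∩ B ∣ ≟ ∣ S ∣) Bs
  ... | no  none = T , id , T⊆U , T∩A , m≤m+n ∣ T ∣ m , All.¬Any⇒All¬ Bs none
  extend-avoiding zero    [] len sep T T⊆U T∩A | yes ()
  -- The bound `m` also drives the recursion, as `Bs Any.─ bad` is not a structural part of `Bs`.
  extend-avoiding (suc m) Bs len sep T T⊆U T∩A | yes bad
    with (∣A∣≡∣B∣ , B⊆U , sepB) , ∣T∩B∣ ← All.lookupAny sep bad
    with y , y∈B , y∉A , y∉T ← fresh-element ∣A∣≡∣B∣ S⊆A T∩A sepB ∣T∩B∣
    with T′ , T∪y⊆T′ , T′⊆U , T′∩A , ∣T′∣≤ , rest ←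
      extend-avoiding m (Bs Any.─ bad)
        (s≤s⁻¹ (≤-trans (≤-reflexive (sym (length-removeAt′ Bs (Any.index bad)))) len))
        (All.─⁺ bad sep)
        (T ∪ ⁅ y ⁆)
        -- `U` will be the union of all white vertices; keeping `T` inside it makes later padding
        -- from outside `U` disjoint from `T`.
        (λ x∈ → [ T⊆U , (λ x∈⁅y⁆ → subst (_∈ U) (sym (x∈⁅y⁆⇒x≡y y x∈⁅y⁆)) (B⊆U y∈B)) ]′
                  (x∈p∪q⁻ T ⁅ y ⁆ x∈))
        (trans (disjoint⇒[p∪q]∩r≡p∩r T ⁅ y ⁆ A
                 (λ x∈⁅y⁆ x∈A → y∉A (subst (_∈ A) (x∈⁅y⁆⇒x≡y y x∈⁅y⁆) x∈A)))
               T∩A)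
    = T′ , T∪y⊆T′ ∘ p⊆p∪q ⁅ y ⁆ , T′⊆U , T′∩A , ∣T′∣≤∣T∣+1+m
    , All.─⁻ bad ∣T′∩B∣≢∣S∣ rest
    where
    open ≤-Reasoning
    B = Any.lookup bad
    ∣T′∣≤∣T∣+1+m : ∣ T′ ∣ ≤ ∣ T ∣ + suc m
    ∣T′∣≤∣T∣+1+m = begin
      ∣ T′ ∣            ≤⟨ ∣T′∣≤ ⟩
      ∣ T ∪ ⁅ y ⁆ ∣ + m ≤⟨ +-monoˡ-≤ m (∣p∪⁅x⁆∣≤1+∣p∣ T y) ⟩
      suc ∣ T ∣ + m     ≡⟨ sym (+-suc ∣ T ∣ m) ⟩
      ∣ T ∣ + suc m     ∎
    T∩B⊂T′∩B : T ∩ B ⊂ T′ ∩ B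
    T∩B⊂T′∩B =
      (λ x∈ → let x∈T , x∈B = x∈p∩q⁻ T B x∈
              in x∈p∩q⁺ (T∪y⊆T′ (p⊆p∪q ⁅ y ⁆ x∈T) , x∈B))
      , y , x∈p∩q⁺ (T∪y⊆T′ (q⊆p∪q T ⁅ y ⁆ (x∈⁅x⁆ y)) , y∈B) , y∉T ∘ p∩q⊆p T B
    ∣T′∩B∣≢∣S∣ : ∣ T′ ∩ B ∣ ≢ ∣ S ∣
    ∣T′∩B∣≢∣S∣ eq = <-irrefl (trans ∣T∩B∣ (sym eq)) (p⊂q⇒∣p∣<∣q∣ T∩B⊂T′∩B)

-- The bound `length Bs + a ≤ k` serves twice: it allows the choice of `S`, and it keeps `T`, which
-- gains at most one element per `B`, within size `k`. Padding outside `U` changes no intersection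
-- with a white vertex.
unique-neighbour : ∀ {A : Subset n} → ∣ A ∣ ≡ k → 0 < a → 2 * a < k →
  ∀ Bs → All (λ B → ∣ B ∣ ≡ k × B ≢ A) Bs → length Bs + a ≤ k →
  suc (length Bs) * k + (k ∸ a) ≤ n →
  ∃[ u ] (∣ u ∣ ≡ k × ∣ u ∩ A ∣ ≡ a × All (λ B → ∣ u ∩ B ∣ ≢ a × B ≢ u) Bs)
unique-neighbour {n} {k} {a} {A} ∣A∣ 0<a 2a<k Bs Bs≢A len large
  with S , S⊆A , refl , sep ← separating-subset ∣A∣ 0<a 2a<k Bs Bs≢A len
  with A⊆U ∷ Bs⊆U ← All-⊆⋃ (A ∷ Bs)
  with T , S⊆T , T⊆U , T∩A , ∣T∣≤ , T-avoids ←
    extend-avoiding {U = ⋃ (A ∷ Bs)} S⊆A (length Bs) Bs ≤-refl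
      (All.zipWith (λ { ((∣B∣ , _) , B⊆U , sepB) → trans ∣A∣ (sym ∣B∣) , (λ {x} → B⊆U {x}) , sepB })
        (Bs≢A , All.zip (Bs⊆U , sep)))
      S (A⊆U ∘ S⊆A) (trans (∩-comm S A) (q⊆p⇒p∩q≡q S⊆A))
  -- Since `S ⊆ T`, at most `k ∸ a` padding points are required, and `large` leaves that many
  -- outside the union of `A` and `Bs`.
  with P , P⊆∁U , ∣P∣ ← subsetOfSize (∁ (⋃ (A ∷ Bs))) (k ∸ ∣ T ∣)
         (≤-trans (∸-monoʳ-≤ k (p⊆q⇒∣p∣≤∣q∣ S⊆T))
           (m≤∣∁⋃∣ (A ∷ Bs) (∣A∣ ∷ All.map proj₁ Bs≢A) large))
  = T ∪ P , ∣T∪P∣≡k , cong ∣_∣ [T∪P]∩A≡S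
  , All.zipWith (λ { (T-avoids-B , B⊆U , sepB) →
        (λ ∣[T∪P]∩B∣ → T-avoids-B (trans (cong ∣_∣ (sym (P-outside B⊆U))) ∣[T∪P]∩B∣))
      , λ { refl → Separates.B∩A≢S sepB [T∪P]∩A≡S } })
    (T-avoids , All.zip (Bs⊆U , sep))
  where
  U = ⋃ (A ∷ Bs)
  P#U : ∀ {x} → x ∈ P → x ∉ U
  P#U = x∈∁p⇒x∉p ∘ P⊆∁U
  ∣T∪P∣≡k : ∣ T ∪ P ∣ ≡ k
  ∣T∪P∣≡k = trans (disjoint⇒∣p∪q∣≡∣p∣+∣q∣ T P (λ x∈T x∈P → P#U x∈P (T⊆U x∈T)))
    (trans (cong (∣ T ∣ +_) ∣P∣)
      (m+[n∸m]≡n (≤-trans ∣T∣≤ (≤-trans (≤-reflexive (+-comm ∣ S ∣ _)) len))))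
  P-outside : ∀ {B} → B ⊆ U → (T ∪ P) ∩ B ≡ T ∩ B
  P-outside {B} B⊆U = disjoint⇒[p∪q]∩r≡p∩r T P B (λ x∈P x∈B → P#U x∈P (B⊆U x∈B))
  [T∪P]∩A≡S : (T ∪ P) ∩ A ≡ S
  [T∪P]∩A≡S = trans (P-outside A⊆U) T∩A

-- Forcing a small white set, one vertex at a time.

module _ (a<k : a < k) (0<a : 0 < a) (2a<k : 2 * a < k)
         (large : suc (k ∸ a) * k + (k ∸ a) ≤ n) where

  private
    G = J n k a a<k

  -- Induction on the white vertices in list order: the head is forced first, with the at most
  -- `k ∸ a` others in the role of `Bs`, and the tail satisfies the same bound.
  few-white⇒ZeroForcing : ∀ (As : List (KSubset n k)) → Unique As → length As ≤ suc (k ∸ a) →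
                          ZeroForcing G (Pred.∁ (_∈ˡ As))
  few-white⇒ZeroForcing []       []             _   = _ , ε , λ _ ()
  few-white⇒ZeroForcing (A ∷ As) (A∉As ∷ distinct) (s≤s len)
    with ∣As∣≤k∸a ← ≤-trans (≤-reflexive (length-map proj₁ As)) len
    with u , ∣u∣ , adjacent , u-avoids ← unique-neighbour (proj₂ A) 0<a 2a<k (map proj₁ As)
           (All.map⁺ (All.map (λ {B} A≢B → proj₂ B , λ B≡A → A≢B (KSubset-≡ (sym B≡A))) A∉As))
           (≤-trans (+-monoˡ-≤ a ∣As∣≤k∸a) (≤-reflexive (m∸n+n≡m (<⇒≤ a<k))))
           (≤-trans (+-monoˡ-≤ (k ∸ a) (*-monoˡ-≤ k (s≤s ∣As∣≤k∸a))) large)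
       | black , steps , all-black ← few-white⇒ZeroForcing As distinct (m≤n⇒m≤1+n len)
    = black , ((u , ∣u∣) , A , force ∣u∣ adjacent (All.map⁻ u-avoids) , blackened) ◅ steps , all-black
    where
    force : ∀ {u} (∣u∣ : ∣ u ∣ ≡ k) → ∣ u ∩ proj₁ A ∣ ≡ a →
            All (λ B → ∣ u ∩ proj₁ B ∣ ≢ a × proj₁ B ≢ u) As →
            CanForce G (Pred.∁ (_∈ˡ A ∷ As)) (u , ∣u∣) A
    force {u} ∣u∣ adj u-avoids = record
      { u-black  = λ
          -- `u` is not `A`, since it would then meet `A` in `k` rather than `a` elements.
          { (here refl)  → <-irrefl (trans (sym adj) (trans (cong ∣_∣ (∩-idem u)) ∣u∣)) a<k
          ; (there u∈As) → proj₂ (All.lookup u-avoids u∈As) refl }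
      ; adjacent = adj
      ; w-white  = λ black → black (here refl)
      ; only     = only
      }
      where
      only : ∀ v → ∣ u ∩ proj₁ v ∣ ≡ a → ¬ ¬ (v ∈ˡ A ∷ As) → v ≡ A
      -- Deciding `v ≡ A` turns the doubly negated whiteness of `v` into an actual equality.
      only v adj-v white with v ≟ᵏ A
      ... | yes v≡A = v≡A
      ... | no  v≢A = ⊥-elim (white λ
        { (here v≡A)   → v≢A v≡A
        ; (there v∈As) → proj₁ (All.lookup u-avoids v∈As) adj-v })
    blackened : Pred.∁ (_∈ˡ As) Pred.≐ (Pred.∁ (_∈ˡ A ∷ As) Pred.∪ Pred.｛ A ｝)
    blackened = to , [ (λ v∉ v∈As → v∉ (there v∈As)) , (λ { refl A∈As → All.lookup A∉As A∈As refl }) ]′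
      where
      to : Pred.∁ (_∈ˡ As) Pred.⊆ (Pred.∁ (_∈ˡ A ∷ As) Pred.∪ Pred.｛ A ｝)
      to {v} v∉As with v ≟ᵏ A
      ... | yes refl = inj₂ refl
      ... | no  v≢A  = inj₁ λ { (here v≡A) → v≢A v≡A ; (there v∈As) → v∉As v∈As }

-- The two bounds combined, with the arithmetic of the parameters.

theorem17 : ∀ (n k a : ℕ) → n ≥ k → (k>a : k > a) →
    n ≥ k * (k ∸ a + 2) ∸ a → k > 2 * a → a ≥ 1 →
    ZeroBlockingNumber (J n k a k>a) (k ∸ a + 2)
theorem17 n k a n≥k k>a n≥ k>2a a≥1 = record
  { attained = removals k>a ∣D∣ E⊆D
             , removals-blocking k>a ∣D∣ E⊆D ∣D─E∣<a a+1<∣E∣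
             , trans (length-tabulate (removal k>a ∣D∣ E⊆D)) ∣E∣
  ; minimal  = λ (mkVertexSet As distinct) blocking → ≮⇒≥ λ few →
      blocking (few-white⇒ZeroForcing k>a a≥1 k>2a large As distinct
        (s≤s⁻¹ (≤-trans few (≤-reflexive (+-comm d 2)))))
  }
  where
  open ≤-Reasoning
  d = k ∸ a
  d+a≡k : d + a ≡ k
  d+a≡k = m∸n+n≡m (<⇒≤ k>a)
  -- The hypothesis on `n`, regrouped as room for `d + 1` white `k`-sets and `d` padding points.
  large : suc d * k + d ≤ n
  large = begin
    suc d * k + d     ≡⟨ cong (_+ d) (*-comm (suc d) k) ⟩
    k * suc d + d     ≡⟨ sym (+-∸-assoc (k * suc d) (<⇒≤ k>a)) ⟩
    k * suc d + k ∸ a ≡⟨ cong (_∸ a) (+-comm (k * suc d) k) ⟩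
    k + k * suc d ∸ a ≡⟨ cong (_∸ a) (sym (*-suc k (suc d))) ⟩
    k * (2 + d) ∸ a   ≡⟨ cong (λ m → k * m ∸ a) (+-comm 2 d) ⟩
    k * (d + 2) ∸ a   ≤⟨ n≥ ⟩
    n                 ∎
  1+k≤n : suc k ≤ ∣ ⊤ {n} ∣
  1+k≤n = begin
    suc k         ≡⟨ +-comm 1 k ⟩
    k + 1         ≤⟨ +-mono-≤ (m≤m+n k (d * k)) (m<n⇒0<n∸m k>a) ⟩
    suc d * k + d ≤⟨ large ⟩
    n             ≡⟨ sym (∣⊤∣≡n n) ⟩
    ∣ ⊤ {n} ∣     ∎
  D,⊆,∣D∣ = subsetOfSize (⊤ {n}) (suc k) 1+k≤n
  D = proj₁ D,⊆,∣D∣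
  ∣D∣ : ∣ D ∣ ≡ suc k
  ∣D∣ = proj₂ (proj₂ D,⊆,∣D∣)
  d+2≤∣D∣ : d + 2 ≤ ∣ D ∣
  d+2≤∣D∣ = begin
    d + 2       ≤⟨ +-monoʳ-≤ d (s≤s a≥1) ⟩
    d + suc a   ≡⟨ +-suc d a ⟩
    suc (d + a) ≡⟨ cong suc d+a≡k ⟩
    suc k       ≡⟨ sym ∣D∣ ⟩
    ∣ D ∣       ∎
  E,⊆,∣E∣ = subsetOfSize D (d + 2) d+2≤∣D∣
  E = proj₁ E,⊆,∣E∣
  E⊆D : E ⊆ D
  E⊆D = proj₁ (proj₂ E,⊆,∣E∣)
  ∣E∣ : ∣ E ∣ ≡ d + 2
  ∣E∣ = proj₂ (proj₂ E,⊆,∣E∣)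
  -- In fact `D ─ E` has `(k + 1) - (d + 2) = a - 1` elements.
  ∣D─E∣<a : ∣ D ─ E ∣ < a
  ∣D─E∣<a = +-cancelˡ-< (d + 2) ∣ D ─ E ∣ a (begin-strict
    d + 2 + ∣ D ─ E ∣ ≡⟨ cong (_+ ∣ D ─ E ∣) (sym ∣E∣) ⟩
    ∣ E ∣ + ∣ D ─ E ∣ ≡⟨ q⊆p⇒∣q∣+∣p─q∣≡∣p∣ E⊆D ⟩
    ∣ D ∣             ≡⟨ ∣D∣ ⟩
    suc k             <⟨ ≤-refl ⟩
    2 + k             ≡⟨ cong (2 +_) (sym d+a≡k) ⟩
    2 + d + a         ≡⟨ cong (_+ a) (+-comm 2 d) ⟩
    d + 2 + a         ∎)
  a<d : a < d
  a<d = +-cancelʳ-< a a d (begin-strict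
    a + a ≡⟨ cong (a +_) (sym (+-identityʳ a)) ⟩
    2 * a <⟨ k>2a ⟩
    k     ≡⟨ sym d+a≡k ⟩
    d + a ∎)
  a+1<∣E∣ : suc a < ∣ E ∣
  a+1<∣E∣ = begin
    2 + a ≤⟨ +-monoʳ-≤ 2 (<⇒≤ a<d) ⟩
    2 + d ≡⟨ +-comm 2 d ⟩
    d + 2 ≡⟨ sym ∣E∣ ⟩
    ∣ E ∣ ∎
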